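{- There exists a planar graph $G_2$ such that for every star forest $F$ in $G_2$ (a subgraph of $G_2$ each of whose components is a star), the graph $G_2-E(F)$ contains $K_4$ as a subgraph (and hence is not $3$-colourable). -}

module Defs where

open import Data.Empty using (⊥)
open import Data.Fin.Base using (Fin; _<_)
open import Data.Fin.Properties using (_≟_)
open import Data.Fin.Subset using (Subset; _∈_)
open import Data.List.Base using (List; []; _∷_; _++_)
open import Data.Nat.Base using (ℕ)
open import Data.Product.Base using (Σ; _×_; _,_; ∃-syntax)
open import Data.Rational.Base using (ℚ; 0ℚ; 1ℚ; _≤_; _+_; _-_; _*_)
open import Data.Sum.Base using (_⊎_)
open import Function.Definitions using (Injective)
open import Level using (0ℓ)
open import Relation.Binary.Core using (Rel)
open import Relation.Binary.Construct.Closure.ReflexiveTransitive using (Star)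
open import Relation.Binary.Definitions using (Symmetric; Irreflexive; Decidable)
open import Relation.Binary.PropositionalEquality using (_≡_; _≢_; ≢-sym)
open import Relation.Nullary using (¬_; ¬?; _×-dec_)
open import Relation.Unary using (Pred)

-- Finite simple graphs, with vertex set Fin n.
record Graph (n : ℕ) : Set₁ where
  field
    Adj        : Rel (Fin n) 0ℓ
    adj?       : Decidable Adj
    adj-sym    : Symmetric Adj
    adj-irrefl : Irreflexive _≡_ Adj

K : (m : ℕ) → Graph m
K m = record
  { Adj        = _≢_
  ; adj?       = λ u v → ¬? (u ≟ v)
  ; adj-sym    = ≢-sym
  ; adj-irrefl = λ u≡v u≢v → u≢v u≡v
  }

-- G has a (not necessarily induced) subgraph isomorphic to H.
Contains : ∀ {m n} → Graph n → Graph m → Set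
Contains {m} {n} G H =
  Σ (Fin m → Fin n) λ φ →
    Injective _≡_ _≡_ φ × (∀ {i j} → Graph.Adj H i j → Graph.Adj G (φ i) (φ j))

Colourable : ∀ {n} → ℕ → Graph n → Set
Colourable {n} k G =
  Σ (Fin n → Fin k) λ c → ∀ {u v} → Graph.Adj G u v → c u ≢ c v

record Subgraph {n : ℕ} (G : Graph n) : Set₁ where
  open Graph G
  field
    vertices  : Subset n
    Edge      : Rel (Fin n) 0ℓ
    edge?     : Decidable Edge
    edge-sym  : Symmetric Edge
    edge⇒adj  : ∀ {u v} → Edge u v → Adj u v
    edge⇒vert : ∀ {u v} → Edge u v → u ∈ vertices

-- G - E(F): all vertices of G are kept.
_-E_ : ∀ {n} (G : Graph n) → Subgraph G → Graph n
G -E F = record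
  { Adj        = λ u v → Adj u v × ¬ Edge u v
  ; adj?       = λ u v → adj? u v ×-dec ¬? (edge? u v)
  ; adj-sym    = λ (a , ¬e) → adj-sym a , λ e → ¬e (edge-sym e)
  ; adj-irrefl = λ u≡v (a , _) → adj-irrefl u≡v a
  }
  where
  open Graph G
  open Subgraph F

-- The graph with vertex set V and the edges of E inside V is a star K₁,ₖ
-- with k ≥ 0.  Allowing k = 0 lets a star forest have isolated vertices.
IsStar : ∀ {n} → Pred (Fin n) 0ℓ → Rel (Fin n) 0ℓ → Set
IsStar V E =
  ∃[ c ] V c
       × (∀ {w} → V w → w ≢ c → E c w)
       × (∀ {x y} → V x → V y → E x y → x ≡ c ⊎ y ≡ c)

-- The stdlib's Star is the reflexive-transitive closure, so Star Edge v is
-- the vertex set of the connected component of v.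
IsStarForest : ∀ {n} {G : Graph n} → Subgraph G → Set
IsStarForest F = ∀ {v} → v ∈ vertices → IsStar (Star Edge v) Edge
  where open Subgraph F

-- Plane drawings, with edges drawn as simple polygonal arcs.  The vertices
-- and bends have rational coordinates.  If two segments with rational
-- endpoints meet in the real plane, their intersection is a rational point
-- or a segment with rational endpoints, so testing rational points detects
-- every crossing in ℝ².  Conversely, any polygonal drawing in ℝ² can be
-- perturbed to one with rational vertices and bends.
Point : Set
Point = ℚ × ℚ

_∈[_,_] : Point → Point → Point → Set
(x , y) ∈[ (a , b) , (c , d) ] =
  ∃[ t ] 0ℚ ≤ t × t ≤ 1ℚ
       × x ≡ (1ℚ - t) * a + t * c
       × y ≡ (1ℚ - t) * b + t * d

-- A polygonal path is given by its list of successive corners.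
_∈ᵖ_ : Point → List Point → Set
x ∈ᵖ (p ∷ q ∷ ps) = x ∈[ p , q ] ⊎ x ∈ᵖ (q ∷ ps)
x ∈ᵖ (_ ∷ [])     = ⊥
x ∈ᵖ []           = ⊥

-- The path has at least one segment and does not touch itself: each segment
-- is nondegenerate and meets the rest of the path only in its own endpoint.
IsArc : List Point → Set
IsArc []               = ⊥
IsArc (_ ∷ [])         = ⊥
IsArc (p ∷ q ∷ [])     = p ≢ q
IsArc (p ∷ q ∷ r ∷ ps) =
    p ≢ q
  × (∀ {x} → x ∈[ p , q ] → x ∈ᵖ (q ∷ r ∷ ps) → x ≡ q)
  × IsArc (q ∷ r ∷ ps)

-- Each edge {u , v} is drawn once, from its smaller to its larger end;
-- bends u v is irrelevant for the other pairs u , v.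
record PlaneDrawing {n : ℕ} (G : Graph n) : Set where
  open Graph G
  field
    pos   : Fin n → Point
    bends : Fin n → Fin n → List Point

  arc : Fin n → Fin n → List Point
  arc u v = pos u ∷ bends u v ++ pos v ∷ []

  field
    pos-injective : Injective _≡_ _≡_ pos
    edge-arc      : ∀ {u v} → u < v → Adj u v → IsArc (arc u v)
    vertex-on-arc : ∀ {u v w} → u < v → Adj u v →
                    pos w ∈ᵖ arc u v → w ≡ u ⊎ w ≡ v
    arcs-meet     : ∀ {u v u′ v′ x} → u < v → Adj u v → u′ < v′ → Adj u′ v′ →
                    (u , v) ≢ (u′ , v′) →
                    x ∈ᵖ arc u v → x ∈ᵖ arc u′ v′ → ∃[ w ] x ≡ pos w

Planar : ∀ {n} → Graph n → Set
Planar = PlaneDrawing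

{-# OPTIONS --safe #-}
module Submission where

-- G₂ is an Apollonian network: starting from a triangle, nine times in a row
-- a vertex is placed at the centroid of every triangular face and joined to
-- its corners, which creates a K₄.  The drawing is plane because the spokes
-- of a triangle T lie inside T but meet the inside of none of its three
-- subtriangles: in the barycentric coordinates of T, a point inside a
-- subtriangle has a strictly smallest coordinate.
--
-- Let F be a star forest, so that every vertex is a leaf or all its
-- neighbours are leaves.  Call a corner of a triangle absorbing if all its
-- F-neighbours inside are its leaves.  If F hits every K₄ and has no edge
-- between the corners of T, then the centre of T has an F-neighbour among the
-- corners; if all corners are absorbing, the centre is a leaf, and replacing
-- its neighbour by it leaves fewer corners with F-neighbours inside, until
-- none is left.  A leaf has its F-neighbour in at most one of the
-- subtriangles, so absorbing corners can be produced by descending.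

open import Defs
open import Data.Empty using (⊥)
open import Data.Fin.Base as Fin using (Fin; zero; suc; combine; remQuot)
open import Data.Fin.Patterns using (0F; 1F; 2F)
open import Data.Fin.Properties as Fin
  using (_≟_; any?; pigeonhole; remQuot-combine; combine-remQuot; +↔⊎)
open import Data.Fin.Subset.Properties using (_∈?_)
open import Data.Integer.Base using (+_)
open import Data.List.Base using (List; []; _∷_; length; filter; allFin)
open import Data.List.Membership.Propositional using (lose) renaming (_∈_ to _∈ˡ_)
open import Data.List.Membership.Propositional.Properties using (∈-filter⁺; ∈-allFin)
open import Data.List.Properties using (filter-notAll)
import Data.List.Relation.Unary.Any as Any
open import Data.Nat.Base as ℕ using (ℕ; zero; suc; s≤s; z≤n)
import Data.Nat.Properties as ℕ
open import Data.Product.Base using (Σ; ∃; ∃-syntax; _×_; _,_; proj₁; proj₂)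
open import Data.Rational.Base as ℚ using (ℚ; 0ℚ; 1ℚ; ½; _/_; _+_; _-_; _*_; -_; _≤_; _<_)
import Data.Rational.Properties as ℚ
open import Data.Rational.Solver using (module +-*-Solver)
open import Data.Sum.Base using (_⊎_; inj₁; inj₂; [_,_]′; map; swap)
open import Data.Sum.Function.Propositional using (_⊎-↔_)
open import Data.Sum.Properties using (inj₂-injective)
open import Data.Vec.Functional using (Vector; updateAt)
open import Data.Vec.Functional.Properties using (updateAt-updates; updateAt-minimal)
open import Function.Base using (_∘_; const; id)
open import Function.Bundles using (_↔_; mk↔ₛ′; Inverse)
open import Function.Definitions using (Injective)
open import Function.Properties.Inverse using (↔-refl; ↔-sym; ↔-trans; ↔⇒↣)
open import Relation.Binary.Construct.Closure.ReflexiveTransitive using (ε; _◅_)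
open import Relation.Binary.Definitions using (tri<; tri≈; tri>)
open import Relation.Binary.PropositionalEquality
open import Relation.Nullary using (¬_; ¬?; Dec; yes; no; contradiction)
open import Relation.Nullary.Decidable using (map′; _⊎-dec_; via-injection)
open import Relation.Unary using (Decidable)
open +-*-Solver using (solve; _:=_; _:+_; _:*_; _:-_; con)

-- Exchanging one corner of a triangle, and the three corner indices.

replace : ∀ {a} {A : Set a} {n} → Vector A n → Fin n → A → Vector A n
replace c j x = updateAt c j (const x)

replace-elim : ∀ {a p} {A : Set a} {n} (P : Fin n → A → Set p) (c : Vector A n) j {x} →
               P j x → (∀ k → k ≢ j → P k (c k)) → ∀ k → P k (replace c j x k)
replace-elim P c j Px Pc k with k ≟ j
... | yes refl = subst (P k) (sym (updateAt-updates k c)) Px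
... | no k≢j  = subst (P k) (sym (updateAt-minimal k j c k≢j)) (Pc k k≢j)

replace-elim₂ : ∀ {a p} {A : Set a} {n} (P : A → A → Set p) (c : Vector A n) j {x} →
                (∀ {u v} → P u v → P v u) → P x x →
                (∀ k → k ≢ j → P x (c k)) → (∀ k l → k ≢ j → l ≢ j → P (c k) (c l)) →
                ∀ k l → P (replace c j x k) (replace c j x l)
replace-elim₂ P c j P-sym Pxx Pxc Pcc k l =
  replace-elim (λ _ u → P u (replace c j _ l)) c j
    (replace-elim (λ _ → P _) c j Pxx Pxc l)
    (λ k k≢j → replace-elim (λ _ → P (c k)) c j (P-sym (Pxc k k≢j)) (λ l → Pcc k l k≢j) l)
    k

other : (i : Fin 3) → ∃[ k ] k ≢ i
other zero    = 1F , λ ()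
other (suc _) = 0F , λ ()

third : {i j : Fin 3} → i ≢ j → ∃[ t ] t ≢ i × t ≢ j × (∀ k → k ≡ i ⊎ k ≡ j ⊎ k ≡ t)
third {0F} {0F} i≢j = contradiction refl i≢j
third {0F} {1F} _ = 2F , (λ ()) , (λ ()) , λ { 0F → inj₁ refl ; 1F → inj₂ (inj₁ refl) ; 2F → inj₂ (inj₂ refl) }
third {0F} {2F} _ = 1F , (λ ()) , (λ ()) , λ { 0F → inj₁ refl ; 1F → inj₂ (inj₂ refl) ; 2F → inj₂ (inj₁ refl) }
third {1F} {0F} _ = 2F , (λ ()) , (λ ()) , λ { 0F → inj₂ (inj₁ refl) ; 1F → inj₁ refl ; 2F → inj₂ (inj₂ refl) }
third {1F} {1F} i≢j = contradiction refl i≢j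
third {1F} {2F} _ = 0F , (λ ()) , (λ ()) , λ { 0F → inj₂ (inj₂ refl) ; 1F → inj₁ refl ; 2F → inj₂ (inj₁ refl) }
third {2F} {0F} _ = 1F , (λ ()) , (λ ()) , λ { 0F → inj₂ (inj₁ refl) ; 1F → inj₂ (inj₂ refl) ; 2F → inj₁ refl }
third {2F} {1F} _ = 0F , (λ ()) , (λ ()) , λ { 0F → inj₂ (inj₂ refl) ; 1F → inj₂ (inj₁ refl) ; 2F → inj₁ refl }
third {2F} {2F} i≢j = contradiction refl i≢j

-- The vertices stacked into a triangle in d rounds: here is its centre, and
-- under j leads to the subtriangle in which the centre replaces corner j.
data Addr : ℕ → Set where
  here  : ∀ {d} → Addr (suc d)
  under : ∀ {d} → Fin 3 → Addr d → Addr (suc d)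

under-injectiveˡ : ∀ {d i j} {α β : Addr d} → under i α ≡ under j β → i ≡ j
under-injectiveˡ refl = refl

under-injectiveʳ : ∀ {d i j} {α β : Addr d} → under i α ≡ under j β → α ≡ β
under-injectiveʳ refl = refl

anyAddr? : ∀ {d} {P : Addr d → Set} → Decidable P → Dec (∃ P)
anyAddr? {zero}  P? = no λ ()
anyAddr? {suc d} P? =
  map′ [ (λ p → here , p) , (λ (j , α , p) → under j α , p) ]′
       (λ { (here , p) → inj₁ p ; (under j α , p) → inj₂ (j , α , p) })
       (P? here ⊎-dec any? λ j → anyAddr? (P? ∘ under j))

-- These are the corners of the triangle that the vertex at a given address is stacked into. `A` is
-- left open so that the same recursion serves abstract vertices, numbered vertices and points of
-- the plane; `corners-map` moves between them.
corners : ∀ {a} {A : Set a} {d} → Vector A 3 → (Addr d → A) → Addr d → Vector A 3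
corners c ι here        = c
corners c ι (under j α) = corners (replace c j (ι here)) (ι ∘ under j) α

corners-map : ∀ {a b} {A : Set a} {B : Set b} {d} (f : A → B) {c c′} {ι : Addr d → A} {ι′} →
              (∀ k → f (c k) ≡ c′ k) → (∀ α → f (ι α) ≡ ι′ α) →
              ∀ α k → f (corners c ι α k) ≡ corners c′ ι′ α k
corners-map f f-c f-ι here = f-c
corners-map f {c} {c′} {ι} {ι′} f-c f-ι (under j α) = corners-map f
  (replace-elim (λ k v → f v ≡ replace c′ j (ι′ here) k) c j
    (trans (f-ι here) (sym (updateAt-updates j c′)))
    λ k k≢j → trans (f-c k) (sym (updateAt-minimal k j c′ k≢j)))
  (f-ι ∘ under j) α

-- Star forests in a stacked triangle.

module StarForest {n : ℕ} {G : Graph n} (F : Subgraph G) (star : IsStarForest F) where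
  open Graph G
  open Subgraph F

  -- In a star with a single edge, each end is a leaf of the other.
  Leaf : Fin n → Fin n → Set
  Leaf v c = Edge v c × (∀ {w} → Edge v w → w ≡ c)

  edge-irrefl : ∀ {v} → ¬ Edge v v
  edge-irrefl e = adj-irrefl refl (edge⇒adj e)

  -- Compare `v` with the hub of its component. If `v` is the hub, any edge at a neighbour `w` must
  -- contain the hub, and `w` is not the hub; otherwise every edge at `v` must lead to the hub.
  -- Isolated vertices and vertices outside `F` fall under the first case vacuously.
  centre-or-leaf : ∀ v → (∀ {w} → Edge v w → Leaf w v) ⊎ ∃ (Leaf v)
  centre-or-leaf v with v ∈? vertices
  ... | no v∉  = inj₁ λ e → contradiction (edge⇒vert e) v∉
  ... | yes v∈ with star v∈
  ... | c , _ , hub , cover with v ≟ c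
  ...   | yes refl = inj₁ λ {w} e → edge-sym e , λ e′ →
                     [ (λ { refl → contradiction e edge-irrefl }) , id ]′
                       (cover (e ◅ ε) (e ◅ e′ ◅ ε) e′)
  ...   | no v≢c  = inj₂ (c , edge-sym (hub ε v≢c) , λ e →
                     [ (λ v≡c → contradiction v≡c v≢c) , id ]′ (cover ε (e ◅ ε) e))

  edge⇒leaf : ∀ {v w} → Edge v w → Leaf v w ⊎ Leaf w v
  edge⇒leaf {v} e with centre-or-leaf v
  ... | inj₁ centre         = inj₂ (centre e)
  ... | inj₂ (c , vc , only) rewrite only e = inj₁ (vc , only)

  K₄ : Set
  K₄ = Contains (G -E F) (K 4)

  -- ι enumerates the vertices stacked into the triangle with corners c.
  record Region {d} (c : Vector (Fin n) 3) (ι : Addr d → Fin n) : Set where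
    field
      corners-adj : ∀ k l → k ≢ l → Adj (c k) (c l)
      stacked     : ∀ α k → Adj (ι α) (corners c ι α k)
      ι-injective : Injective _≡_ _≡_ ι
      outside     : ∀ α k → ι α ≢ c k

  open Region

  child : ∀ {d c} {ι : Addr (suc d) → Fin n} → Region c ι →
          ∀ j → Region (replace c j (ι here)) (ι ∘ under j)
  child {c = c} {ι} R j = record
    { corners-adj = λ k l k≢l → replace-elim (λ k u → k ≢ l → Adj u (c′ l)) c j
        (λ j≢l → replace-elim (λ l v → j ≢ l → Adj (ι here) v) c j
          (contradiction refl) (λ l _ _ → R .stacked here l) l j≢l)
        (λ k k≢j k≢l → replace-elim (λ l v → k ≢ l → Adj (c k) v) c j
          (λ _ → adj-sym (R .stacked here k)) (λ l _ → R .corners-adj k l) l k≢l)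
        k k≢l
    ; stacked     = R .stacked ∘ under j
    ; ι-injective = under-injectiveʳ ∘ R .ι-injective
    ; outside     = λ α → replace-elim (λ _ v → ι (under j α) ≢ v) c j
        (λ eq → contradiction (R .ι-injective eq) λ ()) (λ k _ → R .outside (under j α) k)
    }
    where c′ = replace c j (ι here)

  -- Both range over the addresses of one region, so they pass to the child `j` by composition with
  -- `under j`.
  Avoids Absorbs : ∀ {d} → (Addr d → Fin n) → Fin n → Set
  Avoids  ι v = ∀ α → ¬ Edge v (ι α)
  Absorbs ι v = ∀ α → Edge v (ι α) → Leaf (ι α) v

  Independent : Vector (Fin n) 3 → Set
  Independent c = ∀ k l → ¬ Edge (c k) (c l)

  avoids⇒absorbs : ∀ {d} {ι : Addr d → Fin n} {v} → Avoids ι v → Absorbs ι v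
  avoids⇒absorbs avoids α e = contradiction e (avoids α)

  leaf-avoids : ∀ {d} {ι : Addr d → Fin n} {v q} → Leaf v q → (∀ α → ι α ≢ q) → Avoids ι v
  leaf-avoids (_ , only) q∉ι α e = q∉ι α (only e)

  -- If `v` is a leaf, its one edge is spent on `q` outside the region, so it has no neighbour
  -- inside; otherwise all its neighbours are its leaves.
  tied-absorbs : ∀ {d} {ι : Addr d → Fin n} {v q} → Edge v q → (∀ α → ι α ≢ q) → Absorbs ι v
  tied-absorbs {v = v} e q∉ι α e′ with centre-or-leaf v
  ... | inj₁ centre         = centre e′
  ... | inj₂ (_ , _ , only) = contradiction (trans (only e′) (sym (only e))) (q∉ι α)

  -- The choice that drives the descent. If the centre is a leaf, its single neighbour lies either
  -- in subtriangle `t`, hence in no other one, or outside `t`, and then absorption in `t` is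
  -- vacuous.
  settle : ∀ {d c} {ι : Addr (suc d) → Fin n} → Region c ι → ∀ t →
           Absorbs (ι ∘ under t) (ι here) ⊎ (∀ k → k ≢ t → Avoids (ι ∘ under k) (ι here))
  settle {ι = ι} R t with centre-or-leaf (ι here)
  ... | inj₁ centre = inj₁ λ _ → centre
  ... | inj₂ (q , _ , only) with anyAddr? (λ α → ι (under t α) ≟ q)
  ...   | yes (β , eq) = inj₂ λ k k≢t α e →
          k≢t (under-injectiveˡ (R .ι-injective (trans (only e) (sym eq))))
  ...   | no q∉        = inj₁ λ α e → contradiction (α , only e) q∉

  K₄-or-edge : ∀ {d c} {ι : Addr (suc d) → Fin n} → Region c ι → Independent c →
               K₄ ⊎ ∃[ k ] Edge (c k) (ι here)
  K₄-or-edge {c = c} {ι} R indep with any? (λ k → edge? (c k) (ι here))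
  ... | yes k,e = inj₂ k,e
  ... | no ¬e   = inj₁ (φ , φ-injective , λ {i} {j} → φ-adj i j)
    where
    φ : Fin 4 → Fin n
    φ zero    = ι here
    φ (suc k) = c k

    φ-adj : ∀ i j → i ≢ j → Adj (φ i) (φ j) × ¬ Edge (φ i) (φ j)
    φ-adj zero    zero    i≢j = contradiction refl i≢j
    φ-adj zero    (suc l) i≢j = R .stacked here l , λ e → ¬e (l , edge-sym e)
    φ-adj (suc k) zero    i≢j = adj-sym (R .stacked here k) , λ e → ¬e (k , e)
    φ-adj (suc k) (suc l) i≢j = R .corners-adj k l (i≢j ∘ cong suc) , indep k l

    φ-injective : Injective _≡_ _≡_ φ
    φ-injective {i} {j} eq with i ≟ j
    ... | yes i≡j = i≡j
    ... | no i≢j  = contradiction (proj₁ (φ-adj i j i≢j)) (adj-irrefl eq)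

  independent-child : ∀ {d c} (ι : Addr (suc d) → Fin n) j →
    (∀ k l → k ≢ j → l ≢ j → ¬ Edge (c k) (c l)) → (∀ k → k ≢ j → ¬ Edge (ι here) (c k)) →
    Independent (replace c j (ι here))
  independent-child {c = c} ι j corner-pairs centre-pairs =
    replace-elim₂ (λ u v → ¬ Edge u v) c _ (_∘ edge-sym) edge-irrefl centre-pairs corner-pairs

  -- ks lists the corners that may have neighbours inside; the centre, being a
  -- leaf of one of them, takes its place and leaves the list shorter.
  absorbing⇒K₄ : ∀ {d c} {ι : Addr d → Fin n} (ks : List (Fin 3)) → length ks ℕ.< d →
    Region c ι → Independent c → (∀ k → Absorbs ι (c k)) → (∀ k → k ∈ˡ ks ⊎ Avoids ι (c k)) → K₄
  absorbing⇒K₄ {suc d} {c} {ι} ks (s≤s ks≤d) R indep absorbs active with K₄-or-edge R indep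
  ... | inj₁ K = K
  ... | inj₂ (k , e) with active k
  ...   | inj₂ avoids = contradiction e (avoids here)
  ...   | inj₁ k∈ks   = absorbing⇒K₄ (filter ≢k? ks)
    -- The descent costs one round and `k` leaves the list, so the bound is preserved. It is strict
    -- because one round is still needed when the list is empty.
    (ℕ.≤-trans (filter-notAll ≢k? ks (lose k∈ks (λ k≢k → k≢k refl))) ks≤d)
    (child R k)
    -- The only neighbour of the new corner is the corner it replaces, so an edge to another corner
    -- would identify two adjacent corners.
    (independent-child ι k (λ l l′ _ _ → indep l l′) λ l l≢k e′ →
      adj-irrefl (sym (proj₂ leaf e′)) (R .corners-adj k l (≢-sym l≢k)))
    (replace-elim (λ _ → Absorbs _) c k (avoids⇒absorbs avoids) λ l _ → absorbs l ∘ under k)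
    (replace-elim (λ l v → l ∈ˡ filter ≢k? ks ⊎ Avoids _ v) c k (inj₂ avoids) λ l l≢k →
      map (λ l∈ks → ∈-filter⁺ ≢k? l∈ks l≢k) (_∘ under k) (active l))
    where
    ≢k? : Decidable (_≢ k)
    ≢k? l = ¬? (l ≟ k)

    leaf : Leaf (ι here) (c k)
    leaf = absorbs k here e

    avoids : Avoids (ι ∘ under k) (ι here)
    avoids = leaf-avoids leaf λ α → R .outside (under k α) k

  -- If no `K₄` appears, the centre is joined in `F` to `c i`. Replacing `c i` by the centre leaves
  -- this neighbour outside, so the new corner absorbs by `tied-absorbs`, and the list of active
  -- corners is `i` alone.
  independent-avoiding⇒K₄ : ∀ {e c} {ι : Addr (3 ℕ.+ e) → Fin n} i → Region c ι → Independent c →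
                            (∀ k → k ≢ i → Avoids ι (c k)) → K₄
  independent-avoiding⇒K₄ {c = c} {ι} i R indep avoids with K₄-or-edge R indep
  ... | inj₁ K = K
  ... | inj₂ (k , e) with k ≟ i
  ...   | no k≢i   = contradiction e (avoids k k≢i here)
  ...   | yes refl = absorbing⇒K₄ (i ∷ []) (s≤s (s≤s z≤n)) (child R i)
    (independent-child ι i (λ l l′ _ _ → indep l l′) λ l l≢i e′ → avoids l l≢i here (edge-sym e′))
    (replace-elim (λ _ → Absorbs _) c i
      (tied-absorbs (edge-sym e) λ α → R .outside (under i α) i)
      λ l l≢i → avoids⇒absorbs (avoids l l≢i ∘ under i))
    (replace-elim (λ l v → l ∈ˡ i ∷ [] ⊎ Avoids _ v) c i (inj₁ (Any.here refl)) λ l l≢i →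
      inj₂ (avoids l l≢i ∘ under i))

  -- Putting the centre in place of `c i` discards every `F`-edge at `c i`. The other two corners
  -- avoid the centre, so the new triangle is independent.
  avoiding⇒K₄ : ∀ {e c} {ι : Addr (4 ℕ.+ e) → Fin n} i → Region c ι →
                (∀ k l → k ≢ i → l ≢ i → ¬ Edge (c k) (c l)) →
                (∀ k → k ≢ i → Avoids ι (c k)) → K₄
  avoiding⇒K₄ {c = c} {ι} i R indep avoids = independent-avoiding⇒K₄ i (child R i)
    (independent-child ι i indep λ k k≢i e → avoids k k≢i here (edge-sym e))
    (replace-elim (λ k v → k ≢ i → Avoids _ v) c i (contradiction refl)
      λ k _ k≢i → avoids k k≢i ∘ under i)

  all-absorbing⇒K₄ : ∀ {e c} {ι : Addr (4 ℕ.+ e) → Fin n} → Region c ι → Independent c →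
                     (∀ k → Absorbs ι (c k)) → K₄
  all-absorbing⇒K₄ R indep absorbs =
    absorbing⇒K₄ (allFin 3) (s≤s (s≤s (s≤s (s≤s z≤n)))) R indep absorbs (inj₁ ∘ ∈-allFin)

  -- In subtriangle `m` the corners other than `j` are `c i` and the centre. Both avoid its inside,
  -- and they are not joined in `F` because `c i` avoids the centre too.
  avoiding-child⇒K₄ : ∀ {e c} {ι : Addr (5 ℕ.+ e) → Fin n} (R : Region c ι) {i m j} →
                      (∀ k → k ≢ j → k ≡ i ⊎ k ≡ m) →
                      Avoids ι (c i) → Avoids (ι ∘ under m) (ι here) → K₄
  avoiding-child⇒K₄ {c = c} {ι} R {i} {m} {j} cover ci-avoids r-avoids =
    avoiding⇒K₄ j (child R m) pairs avoids
    where
    r  = ι here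
    c′ = replace c m r

    two : ∀ k → k ≢ j → c′ k ≡ c i ⊎ c′ k ≡ r
    two = replace-elim (λ k v → k ≢ j → v ≡ c i ⊎ v ≡ r) c m (λ _ → inj₂ refl)
      λ k k≢m k≢j → [ inj₁ ∘ cong c , (λ k≡m → contradiction k≡m k≢m) ]′ (cover k k≢j)

    avoids : ∀ k → k ≢ j → Avoids (ι ∘ under m) (c′ k)
    avoids k k≢j with c′ k | two k k≢j
    ... | _ | inj₁ refl = ci-avoids ∘ under m
    ... | _ | inj₂ refl = r-avoids

    pairs : ∀ k l → k ≢ j → l ≢ j → ¬ Edge (c′ k) (c′ l)
    pairs k l k≢j l≢j e with c′ k | c′ l | two k k≢j | two l l≢j
    ... | _ | _ | inj₁ refl | inj₁ refl = edge-irrefl e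
    ... | _ | _ | inj₁ refl | inj₂ refl = ci-avoids here e
    ... | _ | _ | inj₂ refl | inj₁ refl = ci-avoids here (edge-sym e)
    ... | _ | _ | inj₂ refl | inj₂ refl = edge-irrefl e

  corner-injective : ∀ {d c} {ι : Addr d → Fin n} → Region c ι → ∀ {k l} → c k ≡ c l → k ≡ l
  corner-injective R {k} {l} eq with k ≟ l
  ... | yes k≡l = k≡l
  ... | no k≢l  = contradiction (R .corners-adj k l k≢l) (adj-irrefl eq)

  -- The only edge of `c a` goes to `c b`, so `c a` avoids the whole region and replacing `c b`
  -- removes that edge. The centre then either avoids the inside of some child that keeps `c a`, or
  -- becomes a third absorbing corner of an independent triangle.
  leaf-corner⇒K₄ : ∀ {e c} {ι : Addr (5 ℕ.+ e) → Fin n} → Region c ι → ∀ {a b} →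
                   Leaf (c a) (c b) → (∀ k → Absorbs ι (c k)) → K₄
  leaf-corner⇒K₄ {c = c} {ι} R {a} {b} leaf absorbs
    with t , t≢a , t≢b , cover ← third (λ { refl → edge-irrefl (proj₁ leaf) })
    = [ absorbed , avoided ]′ (settle R b)
    where
    a-avoids : Avoids ι (c a)
    a-avoids = leaf-avoids leaf λ α → R .outside α b

    avoided : (∀ k → k ≢ b → Avoids (ι ∘ under k) (ι here)) → K₄
    avoided r-avoids = avoiding-child⇒K₄ R {j = b}
      (λ k k≢b → [ inj₁ , [ (λ k≡b → contradiction k≡b k≢b) , inj₂ ]′ ]′ (cover k))
      a-avoids (r-avoids t t≢b)

    absorbed : Absorbs (ι ∘ under b) (ι here) → K₄
    absorbed r-absorbs with edge? (c t) (ι here)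
    -- As `c t` absorbs, the centre is its leaf and so has no neighbour inside subtriangle `b`.
    ... | yes e = avoiding-child⇒K₄ R {j = t}
      (λ k k≢t → [ inj₁ , [ inj₂ , (λ k≡t → contradiction k≡t k≢t) ]′ ]′ (cover k))
      a-avoids (leaf-avoids (absorbs t here e) λ α → R .outside (under b α) t)
    ... | no ¬e = all-absorbing⇒K₄ (child R b)
      (independent-child ι b pairs centre-pairs)
      (replace-elim (λ _ → Absorbs _) c b r-absorbs λ k _ → absorbs k ∘ under b)
      where
      a-isolated : ∀ l → l ≢ b → ¬ Edge (c a) (c l)
      a-isolated l l≢b e = l≢b (corner-injective R (proj₂ leaf e))

      pairs : ∀ k l → k ≢ b → l ≢ b → ¬ Edge (c k) (c l)
      pairs k l k≢b l≢b e with cover k | cover l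
      ... | inj₁ refl        | _                = a-isolated l l≢b e
      ... | inj₂ (inj₁ k≡b)  | _                = k≢b k≡b
      ... | inj₂ (inj₂ refl) | inj₁ refl        = a-isolated k k≢b (edge-sym e)
      ... | inj₂ (inj₂ refl) | inj₂ (inj₁ l≡b)  = l≢b l≡b
      ... | inj₂ (inj₂ refl) | inj₂ (inj₂ refl) = edge-irrefl e

      centre-pairs : ∀ k → k ≢ b → ¬ Edge (ι here) (c k)
      centre-pairs k k≢b e with cover k
      ... | inj₁ refl        = a-avoids here (edge-sym e)
      ... | inj₂ (inj₁ k≡b)  = k≢b k≡b
      ... | inj₂ (inj₂ refl) = ¬e (edge-sym e)

  absorbing-corners⇒K₄ : ∀ {e c} {ι : Addr (5 ℕ.+ e) → Fin n} → Region c ι →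
                         (∀ k → Absorbs ι (c k)) → K₄
  absorbing-corners⇒K₄ {c = c} R absorbs with any? (λ k → any? λ l → edge? (c k) (c l))
  ... | no ¬e          = all-absorbing⇒K₄ R (λ k l e → ¬e (k , l , e)) absorbs
  ... | yes (k , l , e) =
    [ (λ leaf → leaf-corner⇒K₄ R leaf absorbs) , (λ leaf → leaf-corner⇒K₄ R leaf absorbs) ]′ (edge⇒leaf e)

  -- If the centre absorbs in subtriangle `t`, it replaces the only corner that might not absorb.
  settle-third : ∀ {e c} {ι : Addr (6 ℕ.+ e) → Fin n} → Region c ι → ∀ t →
                 (∀ k → k ≢ t → Absorbs ι (c k)) → K₄ ⊎ (∀ k → k ≢ t → Avoids (ι ∘ under k) (ι here))
  settle-third {c = c} R t absorbs = map
    (λ r-absorbs → absorbing-corners⇒K₄ (child R t)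
      (replace-elim (λ _ → Absorbs _) c t r-absorbs λ k k≢t → absorbs k k≢t ∘ under t))
    id (settle R t)

  -- Settle twice with respect to the third corner `t`, first in the triangle and then in its child
  -- `i`. If neither attempt gives a `K₄`, both centres avoid the inside of child `j` of child `i`,
  -- whose corners are these two centres and `c t`.
  two-absorbing⇒K₄ : ∀ {e c} {ι : Addr (7 ℕ.+ e) → Fin n} → Region c ι → ∀ {i j} → i ≢ j →
                     Absorbs ι (c i) → Absorbs ι (c j) → K₄
  two-absorbing⇒K₄ {c = c} {ι} R {i} {j} i≢j i-absorbs j-absorbs
    with t , t≢i , t≢j , cover ← third i≢j
    = [ id , (λ r-avoids → first (r-avoids i (≢-sym t≢i))) ]′ (settle-third R t absorbs)
    where
    absorbs : ∀ k → k ≢ t → Absorbs ι (c k)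
    absorbs k k≢t with cover k
    ... | inj₁ refl        = i-absorbs
    ... | inj₂ (inj₁ refl) = j-absorbs
    ... | inj₂ (inj₂ k≡t)  = contradiction k≡t k≢t

    first : Avoids (ι ∘ under i) (ι here) → K₄
    first r-avoids = [ id , (λ r′-avoids → avoiding-child⇒K₄ (child R i)
        (λ k k≢t → [ inj₁ , [ inj₂ , (λ k≡t → contradiction k≡t k≢t) ]′ ]′ (cover k))
        (subst (Avoids _) (sym (updateAt-updates i c)) r-avoids)
        (r′-avoids j (≢-sym t≢j))) ]′
      (settle-third (child R i) t
        (replace-elim (λ k v → k ≢ t → Absorbs _ v) c i (λ _ → avoids⇒absorbs r-avoids)
          λ k _ k≢t → absorbs k k≢t ∘ under i))

  -- Besides `c i` there are two corners that can be replaced, and by `settle` the centre absorbs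
  -- after replacing at least one of them.
  one-absorbing⇒K₄ : ∀ {e c} {ι : Addr (8 ℕ.+ e) → Fin n} → Region c ι → ∀ {i} →
                     Absorbs ι (c i) → K₄
  one-absorbing⇒K₄ {c = c} {ι} R {i} i-absorbs with k , k≢i ← other i
    with t , t≢i , t≢k , _ ← third (≢-sym k≢i) =
    [ next k k≢i , (λ r-avoids → next t t≢i (avoids⇒absorbs (r-avoids t t≢k))) ]′ (settle R k)
    where
    next : ∀ k → k ≢ i → Absorbs (ι ∘ under k) (ι here) → K₄
    next k k≢i r-absorbs = two-absorbing⇒K₄ (child R k) k≢i
      (subst (Absorbs _) (sym (updateAt-updates k c)) r-absorbs)
      (subst (Absorbs _) (sym (updateAt-minimal i k c (≢-sym k≢i))) (i-absorbs ∘ under k))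

  -- The count of rounds: four for three independent absorbing corners, a fifth to remove an edge
  -- between corners, a sixth and a seventh for the third absorbing corner, an eighth for the second
  -- and a ninth for the first.
  region⇒K₄ : ∀ {e c} {ι : Addr (9 ℕ.+ e) → Fin n} → Region c ι → K₄
  region⇒K₄ {c = c} {ι} R =
    [ next 0F , (λ r-avoids → next 1F (avoids⇒absorbs (r-avoids 1F λ ()))) ]′ (settle R 0F)
    where
    next : ∀ k → Absorbs (ι ∘ under k) (ι here) → K₄
    next k r-absorbs = one-absorbing⇒K₄ (child R k) {k}
      (subst (Absorbs _) (sym (updateAt-updates k c)) r-absorbs)

-- Affine interpolation and order on the rationals.

⅓ : ℚ
⅓ = + 1 / 3

mix : ℚ → ℚ → ℚ → ℚ
mix t a b = (1ℚ - t) * a + t * b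

lerp : ℚ → Point → Point → Point
lerp t (x , y) (x′ , y′) = mix t x x′ , mix t y y′

Affine : (Point → ℚ) → Set
Affine f = ∀ t p q → f (lerp t p q) ≡ mix t (f p) (f q)

mix-0 : ∀ a b → mix 0ℚ a b ≡ a
mix-0 = solve 2 (λ a b → (con 1ℚ :- con 0ℚ) :* a :+ con 0ℚ :* b := a) refl

mix-1 : ∀ a b → mix 1ℚ a b ≡ b
mix-1 = solve 2 (λ a b → (con 1ℚ :- con 1ℚ) :* a :+ con 1ℚ :* b := b) refl

mix-same : ∀ t a → mix t a a ≡ a
mix-same = solve 2 (λ t a → (con 1ℚ :- t) :* a :+ t :* a := a) refl

mix-flip : ∀ t a b → mix t a b ≡ mix (1ℚ - t) b a
mix-flip = solve 3 (λ t a b → (con 1ℚ :- t) :* a :+ t :* b :=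
                              (con 1ℚ :- (con 1ℚ :- t)) :* b :+ (con 1ℚ :- t) :* a) refl

affine-∸ : ∀ {f g} → Affine f → Affine g → Affine (λ p → f p - g p)
affine-∸ {f} {g} f-aff g-aff t p q rewrite f-aff t p q | g-aff t p q =
  solve 5 (λ t a b c d → (con 1ℚ :- t) :* a :+ t :* b :- ((con 1ℚ :- t) :* c :+ t :* d) :=
                         (con 1ℚ :- t) :* (a :- c) :+ t :* (b :- d))
    refl t (f p) (f q) (g p) (g q)

affine-* : ∀ k {f} → Affine f → Affine (λ p → k * f p)
affine-* k {f} f-aff t p q rewrite f-aff t p q =
  solve 4 (λ k t a b → k :* ((con 1ℚ :- t) :* a :+ t :* b) :=
                       (con 1ℚ :- t) :* (k :* a) :+ t :* (k :* b))
    refl k t (f p) (f q)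

0<q-p⇒p<q : ∀ {p q} → 0ℚ < q - p → p < q
0<q-p⇒p<q {p} {q} lt = subst₂ _<_ (ℚ.+-identityˡ p)
  (solve 2 (λ p q → q :- p :+ p := q) refl p q) (ℚ.+-monoˡ-< p lt)

p<q⇒0<q-p : ∀ {p q} → p < q → 0ℚ < q - p
p<q⇒0<q-p {p} {q} lt = subst (_< q - p) (ℚ.+-inverseʳ p) (ℚ.+-monoˡ-< (- p) lt)

p≤q⇒0≤q-p : ∀ {p q} → p ≤ q → 0ℚ ≤ q - p
p≤q⇒0≤q-p {p} {q} le = subst (_≤ q - p) (ℚ.+-inverseʳ p) (ℚ.+-monoˡ-≤ (- p) le)

<⇒≱ : ∀ {p q} → p < q → ¬ q ≤ p
<⇒≱ p<q q≤p = ℚ.<-irrefl refl (ℚ.<-≤-trans p<q q≤p)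

≤∧≢⇒< : ∀ {p q} → p ≤ q → p ≢ q → p < q
≤∧≢⇒< {p} {q} p≤q p≢q with ℚ.<-cmp p q
... | tri< p<q _ _ = p<q
... | tri≈ _ p≡q _ = contradiction p≡q p≢q
... | tri> _ _ q<p = contradiction p≤q (<⇒≱ q<p)

∈-lerp : ∀ {x p q} → x ∈[ p , q ] → ∃[ t ] 0ℚ ≤ t × t ≤ 1ℚ × x ≡ lerp t p q
∈-lerp (t , 0≤t , t≤1 , eq₁ , eq₂) = t , 0≤t , t≤1 , cong₂ _,_ eq₁ eq₂

∈-left : ∀ {p q} → p ∈[ p , q ]
∈-left {p , p′} {q , q′} = 0ℚ , ℚ.≤-refl , ℚ.<⇒≤ (ℚ.positive⁻¹ 1ℚ) , sym (mix-0 p q) , sym (mix-0 p′ q′)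

∈-flip : ∀ {x p q} → x ∈[ p , q ] → x ∈[ q , p ]
∈-flip {_} {p} {q} (t , 0≤t , t≤1 , eq₁ , eq₂) =
  1ℚ - t , p≤q⇒0≤q-p t≤1 , 1-t≤1 ,
  trans eq₁ (mix-flip t _ _) , trans eq₂ (mix-flip t _ _)
  where
  1-t≤1 : 1ℚ - t ≤ 1ℚ
  1-t≤1 = ℚ.+-monoʳ-≤ 1ℚ (ℚ.neg-antimono-≤ 0≤t)

lerp-0 : ∀ p q → lerp 0ℚ p q ≡ p
lerp-0 (x , y) (x′ , y′) = cong₂ _,_ (mix-0 x x′) (mix-0 y y′)

lerp-1 : ∀ p q → lerp 1ℚ p q ≡ q
lerp-1 (x , y) (x′ , y′) = cong₂ _,_ (mix-1 x x′) (mix-1 y y′)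

-- Barycentric coordinates and centroid subdivision.

record Triangle : Set where
  field
    corner       : Vector Point 3
    coord        : Vector (Point → ℚ) 3
    affine       : ∀ k → Affine (coord k)
    diagonal     : ∀ k → coord k (corner k) ≡ 1ℚ
    off-diagonal : ∀ k l → k ≢ l → coord k (corner l) ≡ 0ℚ

  -- The centroid, as an iterated `lerp` so that `affine` evaluates each coordinate on it.
  centre : Point
  centre = lerp ⅓ (lerp ½ (corner 0F) (corner 1F)) (corner 2F)

  coord-centre : ∀ k → coord k centre ≡ ⅓
  coord-centre k = trans (affine k ⅓ _ _)
    (trans (cong (λ a → mix ⅓ a (coord k (corner 2F))) (affine k ½ _ _)) (values k))
    where
    values : ∀ k → mix ⅓ (mix ½ (coord k (corner 0F)) (coord k (corner 1F))) (coord k (corner 2F)) ≡ ⅓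
    values 0F rewrite diagonal 0F | off-diagonal 0F 1F (λ ()) | off-diagonal 0F 2F (λ ()) = refl
    values 1F rewrite diagonal 1F | off-diagonal 1F 0F (λ ()) | off-diagonal 1F 2F (λ ()) = refl
    values 2F rewrite diagonal 2F | off-diagonal 2F 0F (λ ()) | off-diagonal 2F 1F (λ ()) = refl

  Inside : Point → Set
  Inside x = ∀ k → 0ℚ < coord k x

  centre-inside : Inside centre
  centre-inside k = subst (0ℚ <_) (sym (coord-centre k)) (ℚ.positive⁻¹ ⅓)

  corner-not-inside : ∀ l → ¬ Inside (corner l)
  corner-not-inside l inside with k , k≢l ← other l =
    ℚ.<-irrefl (sym (off-diagonal k l k≢l)) (inside k)

open Triangle

-- If x = Σ aₖ cₖ and r = ⅓ Σ cₖ, then x = 3 aⱼ r + Σ (aₖ - aⱼ) cₖ, which gives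
-- the coordinates of x with respect to r and the corners other than cⱼ.
subtriangle : Triangle → Fin 3 → Triangle
subtriangle T j = record
  { corner       = corner′
  ; coord        = replace differences j (λ p → 3ℚ * coord T j p)
  ; affine       = replace-elim (λ _ → Affine) differences j
      (affine-* 3ℚ (T .affine j)) λ k _ → affine-∸ (T .affine k) (T .affine j)
  ; diagonal     = replace-elim (λ k (f : Point → ℚ) → f (corner′ k) ≡ 1ℚ) differences j
      diagonal-j diagonal-k
  ; off-diagonal = replace-elim (λ k (f : Point → ℚ) → ∀ l → k ≢ l → f (corner′ l) ≡ 0ℚ) differences j
      off-diagonal-j off-diagonal-k
  }
  where
  3ℚ : ℚ
  3ℚ = + 3 / 1

  differences : Vector (Point → ℚ) 3
  differences k p = coord T k p - coord T j p

  corner′ : Vector Point 3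
  corner′ = replace (corner T) j (centre T)

  diagonal-j : 3ℚ * coord T j (corner′ j) ≡ 1ℚ
  diagonal-j rewrite updateAt-updates j {const (centre T)} (corner T) | coord-centre T j = refl

  diagonal-k : ∀ k → k ≢ j → coord T k (corner′ k) - coord T j (corner′ k) ≡ 1ℚ
  diagonal-k k k≢j
    rewrite updateAt-minimal k j {const (centre T)} (corner T) k≢j
          | diagonal T k | off-diagonal T j k (≢-sym k≢j) = refl

  off-diagonal-j : ∀ l → j ≢ l → 3ℚ * coord T j (corner′ l) ≡ 0ℚ
  off-diagonal-j l j≢l
    rewrite updateAt-minimal l j {const (centre T)} (corner T) (≢-sym j≢l) | off-diagonal T j l j≢l = refl

  off-diagonal-k : ∀ k → k ≢ j → ∀ l → k ≢ l → coord T k (corner′ l) - coord T j (corner′ l) ≡ 0ℚ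
  off-diagonal-k k k≢j = replace-elim (λ l p → k ≢ l → coord T k p - coord T j p ≡ 0ℚ) _ j
    (λ _ → centre-k) λ l l≢j → corner-k l (≢-sym l≢j)
    where
    centre-k : coord T k (centre T) - coord T j (centre T) ≡ 0ℚ
    centre-k rewrite coord-centre T k | coord-centre T j = refl

    corner-k : ∀ l → j ≢ l → k ≢ l → coord T k (corner T l) - coord T j (corner T l) ≡ 0ℚ
    corner-k l j≢l k≢l rewrite off-diagonal T k l k≢l | off-diagonal T j l j≢l = refl

inside⇒smallest : ∀ T j {x} → Inside (subtriangle T j) x → ∀ k → k ≢ j → coord T j x < coord T k x
inside⇒smallest T j {x} inside k k≢j =
  0<q-p⇒p<q (subst (λ (f : Point → ℚ) → 0ℚ < f x) (updateAt-minimal k j _ k≢j) (inside k))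

inside⇒positive : ∀ T j {x} → Inside (subtriangle T j) x → 0ℚ < coord T j x
inside⇒positive T j {x} inside = ℚ.*-cancelˡ-<-nonNeg (+ 3 / 1)
  (subst (λ (f : Point → ℚ) → 0ℚ < f x) (updateAt-updates j _) (inside j))

subtriangle-inside : ∀ T j {x} → Inside (subtriangle T j) x → Inside T x
subtriangle-inside T j inside k with k ≟ j
... | yes refl = inside⇒positive T j inside
... | no k≢j   = ℚ.<-trans (inside⇒positive T j inside) (inside⇒smallest T j inside k k≢j)

OnSpoke : Triangle → Fin 3 → Point → Set
OnSpoke T k x = x ∈[ centre T , corner T k ]

module _ (T : Triangle) where

  spoke-coord-≢ : ∀ {k l} t → l ≢ k → coord T l (lerp t (centre T) (corner T k)) ≡ (1ℚ - t) * ⅓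
  spoke-coord-≢ {k} {l} t l≢k
    rewrite T .affine l t (centre T) (corner T k) | coord-centre T l | off-diagonal T l k l≢k =
    solve 2 (λ t a → (con 1ℚ :- t) :* a :+ t :* con 0ℚ := (con 1ℚ :- t) :* a) refl t ⅓

  spoke-coord-≡ : ∀ {k} t → coord T k (lerp t (centre T) (corner T k)) ≡ (1ℚ - t) * ⅓ + t
  spoke-coord-≡ {k} t
    rewrite T .affine k t (centre T) (corner T k) | coord-centre T k | diagonal T k =
    solve 2 (λ t a → (con 1ℚ :- t) :* a :+ t :* con 1ℚ := (con 1ℚ :- t) :* a :+ t) refl t ⅓

  -- Every coordinate on the spoke is at least `(1ℚ - t) * ⅓`, which is positive until the spoke
  -- reaches its corner.
  spoke-inside : ∀ {k x} → OnSpoke T k x → x ≡ corner T k ⊎ Inside T x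
  spoke-inside {k} on with t , 0≤t , t≤1 , refl ← ∈-lerp on with t ℚ.≟ 1ℚ
  ... | yes refl = inj₁ (lerp-1 (centre T) (corner T k))
  ... | no t≢1  = inj₂ inside
    where
    0<rest : 0ℚ < (1ℚ - t) * ⅓
    0<rest = subst (_< (1ℚ - t) * ⅓) (ℚ.*-zeroˡ ⅓) (ℚ.*-monoˡ-<-pos ⅓ (p<q⇒0<q-p (≤∧≢⇒< t≤1 t≢1)))

    inside : Inside T _
    inside l with l ≟ k
    ... | no l≢k   = subst (0ℚ <_) (sym (spoke-coord-≢ t l≢k)) 0<rest
    ... | yes refl = subst (0ℚ <_) (sym (spoke-coord-≡ t)) (ℚ.+-mono-<-≤ 0<rest 0≤t)

  spoke-largest : ∀ {k l x} → OnSpoke T k x → coord T l x ≤ coord T k x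
  spoke-largest {k} {l} on with t , 0≤t , _ , refl ← ∈-lerp on with l ≟ k
  ... | yes refl = ℚ.≤-refl
  ... | no l≢k   = subst₂ _≤_ (trans (ℚ.+-identityʳ ((1ℚ - t) * ⅓)) (sym (spoke-coord-≢ t l≢k)))
                     (sym (spoke-coord-≡ t)) (ℚ.+-monoʳ-≤ ((1ℚ - t) * ⅓) 0≤t)

  -- Inside subtriangle `j`, coordinate `j` is strictly smallest. On the spoke to corner `k`,
  -- coordinate `k` is a largest one and the other two are equal, so neither kind of coordinate can
  -- be strictly smallest.
  spoke-not-inside : ∀ {k x} → OnSpoke T k x → ∀ j → ¬ Inside (subtriangle T j) x
  spoke-not-inside {k} on j inside with k ≟ j
  ... | yes refl with l , l≢j ← other j =
    <⇒≱ (inside⇒smallest T j inside l l≢j) (spoke-largest on)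
  ... | no k≢j with t , _ , _ , refl ← ∈-lerp on with l , l≢k , l≢j , _ ← third k≢j =
    ℚ.<⇒≢ (inside⇒smallest T j inside l l≢j)
      (trans (spoke-coord-≢ t (≢-sym k≢j)) (sym (spoke-coord-≢ t l≢k)))

  -- Away from the centre, coordinate `k` strictly exceeds coordinate `l` on the spoke to corner
  -- `k`; on the spoke to corner `l` it never does.
  spokes-meet : ∀ {k l x} → k ≢ l → OnSpoke T k x → OnSpoke T l x → x ≡ centre T
  spokes-meet {k} {l} k≢l on-k on-l with t , 0≤t , _ , refl ← ∈-lerp on-k with t ℚ.≟ 0ℚ
  ... | yes refl = lerp-0 (centre T) (corner T k)
  ... | no t≢0   = contradiction (spoke-largest on-l) (<⇒≱ (subst₂ _<_
        (trans (ℚ.+-identityʳ ((1ℚ - t) * ⅓)) (sym (spoke-coord-≢ t (≢-sym k≢l)))) (sym (spoke-coord-≡ t))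
        (ℚ.+-monoʳ-< ((1ℚ - t) * ⅓) (≤∧≢⇒< 0≤t (≢-sym t≢0)))))

  centre-not-inside : ∀ j → ¬ Inside (subtriangle T j) (centre T)
  centre-not-inside = spoke-not-inside {0F} ∈-left

triangleAt : ∀ {d} → Triangle → Addr d → Triangle
triangleAt T here        = T
triangleAt T (under j α) = triangleAt (subtriangle T j) α

inside-triangleAt : ∀ {d} T (α : Addr d) {x} → Inside (triangleAt T α) x → Inside T x
inside-triangleAt T here        = id
inside-triangleAt T (under j α) = subtriangle-inside T j ∘ inside-triangleAt (subtriangle T j) α

InsideChild : Triangle → Point → Set
InsideChild T x = ∃[ j ] Inside (subtriangle T j) x

-- Where two addresses part at `i` and `j`, coordinates `i` and `j` of a common inner point would
-- each be strictly less than the other. So one address extends the other, and the point lies in a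
-- child of the larger triangle. This form fits centres and spokes, which meet the inside of no
-- child.
nested : ∀ {d} T (α β : Addr d) {x} → Inside (triangleAt T α) x → Inside (triangleAt T β) x →
         α ≡ β ⊎ InsideChild (triangleAt T α) x ⊎ InsideChild (triangleAt T β) x
nested T here        here        _  _  = inj₁ refl
nested T here        (under j β) _  in-β = inj₂ (inj₁ (j , inside-triangleAt (subtriangle T j) β in-β))
nested T (under i α) here        in-α  _ = inj₂ (inj₂ (i , inside-triangleAt (subtriangle T i) α in-α))
nested T (under i α) (under j β) in-α in-β with i ≟ j
... | yes refl = map (cong (under i)) id (nested (subtriangle T i) α β in-α in-β)
... | no i≢j   = contradiction
  (inside⇒smallest T j (inside-triangleAt (subtriangle T j) β in-β) i i≢j)
  (ℚ.<-asym (inside⇒smallest T i (inside-triangleAt (subtriangle T i) α in-α) j (≢-sym i≢j)))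

-- The corners of a subtriangle are by definition the `replace` that occurs in `corners`.
corners-triangleAt : ∀ {d} T (α : Addr d) →
                     corners (corner T) (centre ∘ triangleAt T) α ≡ corner (triangleAt T α)
corners-triangleAt T here        = refl
corners-triangleAt T (under j α) = corners-triangleAt (subtriangle T j) α

root : Triangle
root = record
  { corner       = corner₀
  ; coord        = coord₀
  ; affine       = affine₀
  ; diagonal     = λ { 0F → refl ; 1F → refl ; 2F → refl }
  ; off-diagonal = off-diagonal₀
  }
  where
  corner₀ : Vector Point 3
  corner₀ 0F = 0ℚ , 0ℚ
  corner₀ 1F = 1ℚ , 0ℚ
  corner₀ 2F = 0ℚ , 1ℚ

  coord₀ : Vector (Point → ℚ) 3
  coord₀ 0F (x , y) = 1ℚ - x - y
  coord₀ 1F (x , _) = x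
  coord₀ 2F (_ , y) = y

  affine₀ : ∀ k → Affine (coord₀ k)
  affine₀ 0F t (a , b) (c , d) =
    solve 5 (λ t a b c d →
        con 1ℚ :- ((con 1ℚ :- t) :* a :+ t :* c) :- ((con 1ℚ :- t) :* b :+ t :* d) :=
        (con 1ℚ :- t) :* (con 1ℚ :- a :- b) :+ t :* (con 1ℚ :- c :- d))
      refl t a b c d
  affine₀ 1F _ _ _ = refl
  affine₀ 2F _ _ _ = refl

  off-diagonal₀ : ∀ k l → k ≢ l → coord₀ k (corner₀ l) ≡ 0ℚ
  off-diagonal₀ 0F 0F k≢l = contradiction refl k≢l
  off-diagonal₀ 0F 1F _   = refl
  off-diagonal₀ 0F 2F _   = refl
  off-diagonal₀ 1F 0F _   = refl
  off-diagonal₀ 1F 1F k≢l = contradiction refl k≢l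
  off-diagonal₀ 1F 2F _   = refl
  off-diagonal₀ 2F 0F _   = refl
  off-diagonal₀ 2F 1F _   = refl
  off-diagonal₀ 2F 2F k≢l = contradiction refl k≢l

module _ (T : Triangle) where

  side-coord : ∀ {k l m x} → m ≢ k → m ≢ l → x ∈[ corner T k , corner T l ] → coord T m x ≡ 0ℚ
  side-coord {k} {l} {m} m≢k m≢l on with t , _ , _ , refl ← ∈-lerp on
    rewrite T .affine m t (corner T k) (corner T l)
          | off-diagonal T m k m≢k | off-diagonal T m l m≢l = mix-same t 0ℚ

  -- Along this side `coord T l` is the parameter `t` itself.
  side-end : ∀ {k l x} → k ≢ l → x ∈[ corner T k , corner T l ] → coord T l x ≡ 0ℚ → x ≡ corner T k
  side-end {k} {l} k≢l on eq with t , _ , _ , refl ← ∈-lerp on =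
    trans (cong (λ t → lerp t (corner T k) (corner T l)) t≡0) (lerp-0 (corner T k) (corner T l))
    where
    t≡0 : t ≡ 0ℚ
    t≡0 rewrite T .affine l t (corner T k) (corner T l)
              | off-diagonal T l k (≢-sym k≢l) | diagonal T l =
      trans (solve 1 (λ t → t := (con 1ℚ :- t) :* con 0ℚ :+ t :* con 1ℚ) refl t) eq

  side-not-inside : ∀ {k l x} → k ≢ l → x ∈[ corner T k , corner T l ] → ¬ Inside T x
  side-not-inside k≢l on inside with m , m≢k , m≢l , _ ← third k≢l =
    ℚ.<-irrefl (sym (side-coord m≢k m≢l on)) (inside m)

-- The closed form is (3^d - 1)/2.
size : ℕ → ℕ
size zero    = zero
size (suc d) = suc (3 ℕ.* size d)

-- The Apollonian network and its straight-line drawing.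

module Apollonian (d : ℕ) where

  Vertex : Set
  Vertex = Fin 3 ⊎ Addr d

  cornersAt : Addr d → Vector Vertex 3
  cornersAt = corners inj₁ inj₂

  -- Links at stacked vertices are oriented from the newer vertex to the older one, so each is a
  -- spoke starting at a centre; `Adjacent` forgets the orientation.
  Link : Vertex → Vertex → Set
  Link (inj₁ k) (inj₁ l) = k ≢ l
  Link (inj₁ _) (inj₂ _) = ⊥
  Link (inj₂ α) v        = ∃[ k ] cornersAt α k ≡ v

  △ : Addr d → Triangle
  △ = triangleAt root

  position : Vertex → Point
  position (inj₁ k) = corner root k
  position (inj₂ α) = centre (△ α)

  position-corner : ∀ α k → position (cornersAt α k) ≡ corner (△ α) k
  position-corner α k = trans
    (corners-map position {c′ = corner root} {ι′ = centre ∘ △} (λ _ → refl) (λ _ → refl) α k)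
    (cong (λ c → c k) (corners-triangleAt root α))

  inner-inside : ∀ α → Inside root (position (inj₂ α))
  inner-inside α = inside-triangleAt root α (centre-inside (△ α))

  -- For two stacked vertices, `nested` would put a shared centre inside a child of its own
  -- triangle.
  position-injective : Injective _≡_ _≡_ position
  position-injective {inj₁ k} {inj₁ l} eq with k ≟ l
  ... | yes refl = refl
  ... | no k≢l   = contradiction
    (trans (sym (diagonal root k)) (trans (cong (coord root k) eq) (off-diagonal root k l k≢l))) λ ()
  position-injective {inj₁ k} {inj₂ α} eq =
    contradiction (subst (Inside root) (sym eq) (inner-inside α)) (corner-not-inside root k)
  position-injective {inj₂ α} {inj₁ k} eq =
    contradiction (subst (Inside root) eq (inner-inside α)) (corner-not-inside root k)
  position-injective {inj₂ α} {inj₂ β} eq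
    with nested root α β (centre-inside (△ α)) (subst (Inside (△ β)) (sym eq) (centre-inside (△ β)))
  ... | inj₁ refl            = refl
  ... | inj₂ (inj₁ (j , in-j)) = contradiction in-j (centre-not-inside (△ α) j)
  ... | inj₂ (inj₂ (j , in-j)) =
    contradiction (subst (Inside (subtriangle (△ β) j)) eq in-j) (centre-not-inside (△ β) j)

  link-irrefl : ∀ {v} → ¬ Link v v
  link-irrefl {inj₁ _} k≢k      = k≢k refl
  link-irrefl {inj₂ α} (k , eq) = corner-not-inside (△ α) k
    (subst (Inside (△ α)) (trans (cong position (sym eq)) (position-corner α k)) (centre-inside (△ α)))

  Segment : Vertex → Vertex → Point → Set
  Segment u v x = x ∈[ position u , position v ]

  spoke-segment : ∀ α k {x} → Segment (inj₂ α) (cornersAt α k) x → OnSpoke (△ α) k x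
  spoke-segment α k {x} = subst (λ p → x ∈[ centre (△ α) , p ]) (position-corner α k)

  -- Short of its end, a spoke of `α` runs inside `△ α`. Another centre `β` on it would lie inside a
  -- child of `△ α`, which spokes miss, or inside a child of `△ β`, which its own centre misses.
  vertex-on-link : ∀ {u v} w → Link u v → Segment u v (position w) → w ≡ u ⊎ w ≡ v
  vertex-on-link {inj₁ k} {inj₁ l} (inj₁ m) k≢l on with m ≟ k | m ≟ l
  ... | yes refl | _        = inj₁ refl
  ... | no _     | yes refl = inj₂ refl
  ... | no m≢k   | no m≢l   =
    contradiction (trans (sym (diagonal root m)) (side-coord root m≢k m≢l on)) λ ()
  vertex-on-link {inj₁ k} {inj₁ l} (inj₂ α) k≢l on =
    contradiction (inner-inside α) (side-not-inside root k≢l on)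
  vertex-on-link {inj₂ α} w (k , refl) on
    with on′ ← spoke-segment α k on with spoke-inside (△ α) on′
  ... | inj₁ eq = inj₂ (position-injective (trans eq (sym (position-corner α k))))
  ... | inj₂ inside with w
  ...   | inj₁ m = contradiction (inside-triangleAt root α inside) (corner-not-inside root m)
  ...   | inj₂ β with nested root α β inside (centre-inside (△ β))
  ...     | inj₁ refl              = inj₁ refl
  ...     | inj₂ (inj₁ (j , in-j)) = contradiction in-j (spoke-not-inside (△ α) on′ j)
  ...     | inj₂ (inj₂ (j , in-j)) = contradiction in-j (centre-not-inside (△ β) j)

  SameEnds : (u v u′ v′ : Vertex) → Set
  SameEnds u v u′ v′ = u ≡ u′ × v ≡ v′ ⊎ u ≡ v′ × v ≡ u′

  -- Different sides of the root triangle have an end of the second that is not on the first. Its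
  -- coordinate vanishes along the first side, which forces the common point to be the other end of
  -- the second.
  sides-meet : ∀ {k l k′ l′ x} → k ≢ l → k′ ≢ l′ →
    ¬ SameEnds (inj₁ k) (inj₁ l) (inj₁ k′) (inj₁ l′) →
    Segment (inj₁ k) (inj₁ l) x → Segment (inj₁ k′) (inj₁ l′) x → ∃[ w ] x ≡ position w
  sides-meet {k} {l} {k′} {l′} k≢l k′≢l′ ≢ends on on′ with l′ ≟ k | l′ ≟ l | k′ ≟ k | k′ ≟ l
  ... | no l′≢k  | no l′≢l  | _        | _        =
    inj₁ k′ , side-end root k′≢l′ on′ (side-coord root l′≢k l′≢l on)
  ... | _        | _        | no k′≢k  | no k′≢l  =
    inj₁ l′ , side-end root (≢-sym k′≢l′) (∈-flip on′) (side-coord root k′≢k k′≢l on)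
  ... | yes refl | _        | yes refl | _        = contradiction refl k′≢l′
  ... | yes refl | _        | _        | yes refl = contradiction (inj₂ (refl , refl)) ≢ends
  ... | _        | yes refl | yes refl | _        = contradiction (inj₁ (refl , refl)) ≢ends
  ... | _        | yes refl | _        | yes refl = contradiction refl k′≢l′

  spoke-in-root : ∀ α k {x} → Segment (inj₂ α) (cornersAt α k) x → (∃[ w ] x ≡ position w) ⊎ Inside root x
  spoke-in-root α k on = map
    (λ eq → cornersAt α k , trans eq (sym (position-corner α k)))
    (inside-triangleAt root α)
    (spoke-inside (△ α) (spoke-segment α k on))

  -- A spoke meets the boundary of the root at most in its end. Two spokes meeting short of their
  -- ends belong to the same triangle by `nested`, and then they meet in its centre.
  links-meet : ∀ {u v u′ v′ x} → Link u v → Link u′ v′ → ¬ SameEnds u v u′ v′ →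
               Segment u v x → Segment u′ v′ x → ∃[ w ] x ≡ position w
  links-meet {inj₁ k} {inj₁ l} {inj₁ k′} {inj₁ l′} = sides-meet
  links-meet {inj₁ k} {inj₁ l} {inj₂ α} k≢l (i , refl) _ on on′ =
    [ id , (λ inside → contradiction inside (side-not-inside root k≢l on)) ]′ (spoke-in-root α i on′)
  links-meet {inj₂ α} {_} {inj₁ k} {inj₁ l} (i , refl) k≢l _ on on′ =
    [ id , (λ inside → contradiction inside (side-not-inside root k≢l on′)) ]′ (spoke-in-root α i on)
  links-meet {inj₂ α} {_} {inj₂ β} (k , refl) (l , refl) ≢ends on₀ on₀′
    with on ← spoke-segment α k on₀ | on′ ← spoke-segment β l on₀′
    with spoke-inside (△ α) on | spoke-inside (△ β) on′
  ... | inj₁ eq   | _         = cornersAt α k , trans eq (sym (position-corner α k))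
  ... | inj₂ _    | inj₁ eq   = cornersAt β l , trans eq (sym (position-corner β l))
  ... | inj₂ in-α | inj₂ in-β with nested root α β in-α in-β
  ...   | inj₂ (inj₁ (j , in-j)) = contradiction in-j (spoke-not-inside (△ α) on j)
  ...   | inj₂ (inj₂ (j , in-j)) = contradiction in-j (spoke-not-inside (△ β) on′ j)
  ...   | inj₁ refl with k ≟ l
  ...     | yes refl = contradiction (inj₁ (refl , refl)) ≢ends
  ...     | no k≢l   = inj₂ α , spokes-meet (△ α) k≢l on on′

  Adjacent : Vertex → Vertex → Set
  Adjacent u v = Link u v ⊎ Link v u

  adjacent-vertex : ∀ {u v w} → Adjacent u v → Segment u v (position w) → w ≡ u ⊎ w ≡ v
  adjacent-vertex (inj₁ uv) on = vertex-on-link _ uv on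
  adjacent-vertex (inj₂ vu) on = swap (vertex-on-link _ vu (∈-flip on))

  adjacent-meet : ∀ {u v u′ v′ x} → Adjacent u v → Adjacent u′ v′ → ¬ SameEnds u v u′ v′ →
                  Segment u v x → Segment u′ v′ x → ∃[ w ] x ≡ position w
  adjacent-meet (inj₁ uv) (inj₁ uv′) ≢ends on on′ = links-meet uv uv′ ≢ends on on′
  adjacent-meet (inj₁ uv) (inj₂ vu′) ≢ends on on′ = links-meet uv vu′ (≢ends ∘ swap) on (∈-flip on′)
  adjacent-meet (inj₂ vu) (inj₁ uv′) ≢ends on on′ =
    links-meet vu uv′ (≢ends ∘ [ inj₂ ∘ (λ (p , q) → q , p) , inj₁ ∘ (λ (p , q) → q , p) ]′) (∈-flip on) on′
  adjacent-meet (inj₂ vu) (inj₂ vu′) ≢ends on on′ =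
    links-meet vu vu′ (≢ends ∘ [ inj₁ ∘ (λ (p , q) → q , p) , inj₂ ∘ (λ (p , q) → q , p) ]′)
      (∈-flip on) (∈-flip on′)

-- Numbering the vertices and assembling the graph.

addr↔fin : ∀ d → Addr d ↔ Fin (size d)
addr↔fin d = mk↔ₛ′ to from to∘from from∘to
  where
  to : ∀ {d} → Addr d → Fin (size d)
  to here        = zero
  to (under j α) = suc (combine j (to α))

  from : ∀ {d} → Fin (size d) → Addr d
  from {suc d} zero    = here
  from {suc d} (suc i) with j , i′ ← remQuot {3} (size d) i = under j (from i′)

  to∘from : ∀ {d} (i : Fin (size d)) → to (from i) ≡ i
  to∘from {suc d} zero    = refl
  to∘from {suc d} (suc i) = cong suc (trans
    (cong (combine (proj₁ (remQuot {3} (size d) i))) (to∘from (proj₂ (remQuot {3} (size d) i))))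
    (combine-remQuot {3} (size d) i))

  from∘to : ∀ {d} (α : Addr d) → from (to α) ≡ α
  from∘to here        = refl
  from∘to (under j α) = trans
    (cong (λ (j , i) → under j (from i)) (remQuot-combine j (to α)))
    (cong (under j) (from∘to α))

module Numbered (d : ℕ) {n : ℕ} (vertex↔fin : Apollonian.Vertex d ↔ Fin n) where
  open Apollonian d
  open Inverse vertex↔fin renaming
    ( to to encode ; from to decode
    ; strictlyInverseˡ to encode-decode ; strictlyInverseʳ to decode-encode )

  link? : ∀ u v → Dec (Link u v)
  link? (inj₁ k) (inj₁ l) = ¬? (k ≟ l)
  link? (inj₁ _) (inj₂ _) = no λ ()
  link? (inj₂ α) v        = any? λ k → via-injection (↔⇒↣ vertex↔fin) _≟_ (cornersAt α k) v

  graph : Graph n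
  graph = record
    { Adj        = λ i j → Adjacent (decode i) (decode j)
    ; adj?       = λ i j → link? (decode i) (decode j) ⊎-dec link? (decode j) (decode i)
    ; adj-sym    = swap
    ; adj-irrefl = λ { refl → [ link-irrefl , link-irrefl ]′ }
    }

  open Graph graph

  decode-injective : ∀ {i j} → decode i ≡ decode j → i ≡ j
  decode-injective {i} {j} eq = trans (sym (encode-decode i)) (trans (cong encode eq) (encode-decode j))

  -- Crosswise equal ends would give both `u < v` and `v < u`.
  ends-differ : ∀ {u v u′ v′} → u Fin.< v → u′ Fin.< v′ → (u , v) ≢ (u′ , v′) →
                ¬ SameEnds (decode u) (decode v) (decode u′) (decode v′)
  ends-differ u<v u′<v′ ≢pair (inj₁ (p , q)) = ≢pair (cong₂ _,_ (decode-injective p) (decode-injective q))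
  ends-differ u<v u′<v′ ≢pair (inj₂ (p , q)) with refl ← decode-injective p | refl ← decode-injective q =
    Fin.<-asym u<v u′<v′

  drawing : PlaneDrawing graph
  drawing = record
    { pos           = position ∘ decode
    -- Edges are straight, so an arc is one segment and membership in it is always `inj₁`.
    ; bends         = λ _ _ → []
    ; pos-injective = decode-injective ∘ position-injective
    ; edge-arc      = λ _ uv eq → adj-irrefl (decode-injective (position-injective eq)) uv
    ; vertex-on-arc = λ { _ uv (inj₁ on) → map decode-injective decode-injective (adjacent-vertex uv on) }
    ; arcs-meet     = λ { u<v uv u′<v′ uv′ ≢pair (inj₁ on) (inj₁ on′) →
        let w , x≡w = adjacent-meet uv uv′ (ends-differ u<v u′<v′ ≢pair) on on′ in
        encode w , trans x≡w (cong position (sym (decode-encode w))) }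
    }

  module _ (F : Subgraph graph) (star : IsStarForest F) where
    open StarForest F star

    region : Region (encode ∘ inj₁) (encode ∘ inj₂)
    region = record
      { corners-adj = λ k l k≢l → subst₂ Adjacent
          (sym (decode-encode (inj₁ k))) (sym (decode-encode (inj₁ l))) (inj₁ k≢l)
      ; stacked     = λ α k → subst₂ Adjacent
          (sym (decode-encode (inj₂ α)))
          (sym (corners-map decode (decode-encode ∘ inj₁) (decode-encode ∘ inj₂) α k))
          (inj₁ (k , refl))
      ; ι-injective = λ eq → inj₂-injective (encode-injective eq)
      ; outside     = λ α k eq → contradiction (encode-injective {inj₂ α} {inj₁ k} eq) λ ()
      }
      where
      encode-injective : ∀ {u v} → encode u ≡ encode v → u ≡ v
      encode-injective {u} {v} eq = trans (sym (decode-encode u)) (trans (cong decode eq) (decode-encode v))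

K₄⇒¬3-colourable : ∀ {n} {G : Graph n} → Contains G (K 4) → ¬ Colourable 3 G
K₄⇒¬3-colourable (φ , _ , φ-adj) (colour , proper)
  with i , j , i<j , eq ← pigeonhole (ℕ.n<1+n 3) (colour ∘ φ) =
  proper (φ-adj (Fin.<⇒≢ i<j)) eq

theorem7 : Σ ℕ λ n → Σ (Graph n) λ G₂ → Planar G₂ ×
    ((F : Subgraph G₂) → IsStarForest F →
    Contains (G₂ -E F) (K 4) × ¬ Colourable 3 (G₂ -E F))
-- Nine is the depth that `region⇒K₄` asks for; with the three outer corners the graph has 3 + 9841
-- = 9844 vertices.
theorem7 = 3 ℕ.+ size 9 , graph , drawing , λ F star →
  let K = StarForest.region⇒K₄ F star (region F star) in K , K₄⇒¬3-colourable {G = graph -E F} K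
  where open Numbered 9 (↔-trans (↔-refl ⊎-↔ addr↔fin 9) (↔-sym +↔⊎))
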